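{- (i) Let $I,J$ be sets and $R\colon I\times J\to\{0,1\}\subseteq[0,1]$ a boolean ($\{0,1\}$-valued) relation. Then $f_R(x)\cdot f_R(y)\le f_R(x\cdot y)$ for all $x,y\in[0,1]^I$. (ii) Let $\mathbf A,\mathbf B$ be semisimple Pavelka algebras and $f\colon A\to B$, $g\colon B\to A$ with $f\leftrightarrows g$. If $f(x)\cdot f(y)\le f(x\cdot y)$ for all $x,y\in A$, then the relation $R\colon\mathrm{Spec_M}\mathbf A\times\mathrm{Spec_M}\mathbf B\to[0,1]$, $R(F,G)=\bigwedge_{a\in A}(f(a)/G\rightarrow a/F)$, is $\{0,1\}$-valued.
   Context: An MV-algebra $(A;\oplus,\neg,0)$ carries derived operations $1=\neg0$, $x\cdot y=\neg(\neg x\oplus\neg y)$, $x\rightarrow y=\neg x\oplus y$, order $x\le y$ iff $\neg x\oplus y=1$. The standard MV-algebra is $[0,1]$ with $x\oplus y=\min\{x+y,1\}$, $\neg x=1-x$. A Pavelka algebra is $\mathbf A=(A;\oplus,\neg,\{\mathbf r\mid r\in[0,1]\cap\mathbb Q\})$ with $(A;\oplus,\neg,\mathbf 0)$ an MV-algebra, $\mathbf r\oplus\mathbf s=\mathbf t$ whenever $\min\{r+s,1\}=t$, $\neg\mathbf r=\mathbf s$ whenever $1-r=s$. Filters are filters of the MV-reduct; $\mathrm{Spec_M}\mathbf A$ is the set of maximal proper filters; for $F\in\mathrm{Spec_M}\mathbf A$, $\mathbf A/F$ embeds uniquely into the standard Pavelka algebra $[0,1]$ and $x/F$ is identified with its image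 in $[0,1]$. $\mathbf A$ is semisimple if its MV-reduct is a subdirect product of simple MV-algebras. $f\leftrightarrows g$ means: $f,g$ monotone, $x\le f(y)$ iff $g(x)\le y$ for all $y\in A,x\in B$, and $\mathbf r\rightarrow f(y)=f(\mathbf r\rightarrow y)$ for all $y\in A$ and constants $\mathbf r$. For $R\colon I\times J\to[0,1]$: $f_R(x)(j)=\bigwedge_{i\in I}(R(i,j)\rightarrow x(i))$ for $x\in[0,1]^I$, with operations of $[0,1]$ applied componentwise. -}

module Defs where

open import Level using (Level; _⊔_; 0ℓ) renaming (suc to lsuc)
open import Algebra.Structures using (IsCommutativeMonoid)
open import Axiom.ExcludedMiddle using (ExcludedMiddle)
open import Data.Nat.Base as ℕ using (ℕ; zero; suc)
import Data.Nat.Properties as ℕ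
import Data.Nat.Coprimality as ℕ
import Data.Integer.Base as ℤ
import Data.Integer.Properties as ℤ
open import Data.Integer.Solver using () renaming (module +-*-Solver to ℤ-Solver)
import Data.Rational.Unnormalised.Base as ℚᵘ
import Data.Rational.Unnormalised.Properties as ℚᵘ
open import Data.Rational.Base as ℚ using (ℚ; mkℚ; 0ℚ; 1ℚ; toℚᵘ)
import Data.Rational.Properties as ℚ
open import Data.Rational.Solver using () renaming (module +-*-Solver to ℚ-Solver)
open import Data.Product using (Σ; ∃; _×_; _,_; proj₁; proj₂)
open import Data.Sum using (_⊎_; inj₁; inj₂)
open import Data.Empty using (⊥; ⊥-elim)
open import Function.Base using (_∘_)
open import Function.Definitions using (Congruent; Injective; Surjective)
open import Relation.Binary.Core using (Rel)
open import Relation.Binary.Structures using (IsEquivalence)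
open import Relation.Binary.Definitions using (Tri; tri<; tri≈; tri>)
open import Relation.Binary.PropositionalEquality as ≡ using (_≡_; refl; subst)
import Relation.Binary.Reasoning.Setoid as SetoidReasoning
open import Relation.Nullary using (¬_; yes; no)
open import Relation.Nullary.Decidable using (True; toWitness; fromWitness)
open import Algebra.Bundles using (CommutativeMonoid)
import Algebra.Properties.CommutativeSemigroup as CommutativeSemigroupProperties

private variable
  a b c d ℓ ℓ′ i : Level

record ℚ₀₁ : Set where
  constructor mkℚ₀₁
  field
    val : ℚ
    0≤val : 0ℚ ℚ.≤ val
    val≤1 : val ℚ.≤ 1ℚ

open ℚ₀₁

0₀₁ 1₀₁ : ℚ₀₁
0₀₁ = mkℚ₀₁ 0ℚ ℚ.≤-refl (ℚ.nonNegative⁻¹ 1ℚ)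
1₀₁ = mkℚ₀₁ 1ℚ (ℚ.nonNegative⁻¹ 1ℚ) ℚ.≤-refl

record RawMVAlgebra c ℓ : Set (lsuc (c ⊔ ℓ)) where
  infix  8 ∼_
  infixl 7 _·_
  infixl 6 _⊕_
  infixr 5 _⇒_
  infix  4 _≈_ _≤_
  field
    Carrier : Set c
    _≈_     : Rel Carrier ℓ
    _⊕_     : Carrier → Carrier → Carrier
    ∼_      : Carrier → Carrier
    0#      : Carrier

  1# : Carrier
  1# = ∼ 0#

  _·_ : Carrier → Carrier → Carrier
  x · y = ∼ (∼ x ⊕ ∼ y)

  _⇒_ : Carrier → Carrier → Carrier
  x ⇒ y = ∼ x ⊕ y

  _≤_ : Rel Carrier ℓ
  x ≤ y = ∼ x ⊕ y ≈ 1#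

record IsMVAlgebra (M : RawMVAlgebra c ℓ) : Set (c ⊔ ℓ) where
  open RawMVAlgebra M
  field
    ⊕-isCommutativeMonoid : IsCommutativeMonoid _≈_ _⊕_ 0#
    ∼-cong                : ∀ {x y} → x ≈ y → ∼ x ≈ ∼ y
    ∼-involutive          : ∀ x → ∼ ∼ x ≈ x
    ⊕-zeroʳ               : ∀ x → x ⊕ ∼ 0# ≈ ∼ 0#
    łukasiewicz           : ∀ x y → ∼ (∼ x ⊕ y) ⊕ y ≈ ∼ (∼ y ⊕ x) ⊕ x

record MVAlgebra c ℓ : Set (lsuc (c ⊔ ℓ)) where
  field
    raw         : RawMVAlgebra c ℓ
    isMVAlgebra : IsMVAlgebra raw
  open RawMVAlgebra raw public
  open IsMVAlgebra isMVAlgebra public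

record RawPavelkaAlgebra c ℓ : Set (lsuc (c ⊔ ℓ)) where
  infix  8 ∼_
  infixl 6 _⊕_
  infix  4 _≈_
  field
    Carrier : Set c
    _≈_     : Rel Carrier ℓ
    _⊕_     : Carrier → Carrier → Carrier
    ∼_      : Carrier → Carrier
    const   : ℚ₀₁ → Carrier

  rawMVAlgebra : RawMVAlgebra c ℓ
  rawMVAlgebra = record
    { Carrier = Carrier ; _≈_ = _≈_ ; _⊕_ = _⊕_ ; ∼_ = ∼_ ; 0# = const 0₀₁ }

  open RawMVAlgebra rawMVAlgebra public using (0#; 1#; _·_; _⇒_; _≤_)

record PavelkaAlgebra c ℓ : Set (lsuc (c ⊔ ℓ)) where
  field
    raw : RawPavelkaAlgebra c ℓ
  open RawPavelkaAlgebra raw using (rawMVAlgebra; const) public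
  open RawMVAlgebra rawMVAlgebra public
  field
    isMVAlgebra : IsMVAlgebra rawMVAlgebra
    const-⊕     : ∀ r s t → (val r ℚ.+ val s) ℚ.⊓ 1ℚ ≡ val t → const r ⊕ const s ≈ const t
    const-∼     : ∀ r s → 1ℚ ℚ.- val r ≡ val s → ∼ const r ≈ const s
  open IsMVAlgebra isMVAlgebra public

  mvReduct : MVAlgebra c ℓ
  mvReduct = record { isMVAlgebra = isMVAlgebra }

record IsMVHomomorphism (M : RawMVAlgebra a ℓ) (N : RawMVAlgebra b ℓ′)
         (h : RawMVAlgebra.Carrier M → RawMVAlgebra.Carrier N) : Set (a ⊔ ℓ ⊔ ℓ′) where
  private
    module M = RawMVAlgebra M
    module N = RawMVAlgebra N
  field
    cong   : Congruent M._≈_ N._≈_ h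
    ⊕-homo : ∀ x y → h (x M.⊕ y) N.≈ h x N.⊕ h y
    ∼-homo : ∀ x → h (M.∼ x) N.≈ N.∼ h x
    0-homo : h M.0# N.≈ N.0#

record IsPavelkaMonomorphism (P : RawPavelkaAlgebra a ℓ) (Q : RawPavelkaAlgebra b ℓ′)
         (h : RawPavelkaAlgebra.Carrier P → RawPavelkaAlgebra.Carrier Q) : Set (a ⊔ ℓ ⊔ ℓ′) where
  private
    module P = RawPavelkaAlgebra P
    module Q = RawPavelkaAlgebra Q
  field
    cong       : Congruent P._≈_ Q._≈_ h
    ⊕-homo     : ∀ x y → h (x P.⊕ y) Q.≈ (h x Q.⊕ h y)
    ∼-homo     : ∀ x → h (P.∼ x) Q.≈ (Q.∼ h x)
    const-homo : ∀ r → h (P.const r) Q.≈ Q.const r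
    injective  : Injective P._≈_ Q._≈_ h

record IsFilter (M : RawMVAlgebra c ℓ) (F : RawMVAlgebra.Carrier M → Set d) : Set (c ⊔ ℓ ⊔ d) where
  open RawMVAlgebra M
  field
    1∈       : F 1#
    ·-closed : ∀ {x y} → F x → F y → F (x · y)
    ≤-closed : ∀ {x y} → x ≤ y → F x → F y

record MaximalFilter (A : PavelkaAlgebra c ℓ) : Set (lsuc (c ⊔ ℓ)) where
  open PavelkaAlgebra A
  field
    mem      : Carrier → Set (c ⊔ ℓ)
    isFilter : IsFilter rawMVAlgebra mem
    proper   : ¬ mem 0#
    maximal  : (G : Carrier → Set (c ⊔ ℓ)) → IsFilter rawMVAlgebra G → ¬ G 0# →
               (∀ {x} → mem x → G x) → ∀ {x} → G x → mem x
  open IsFilter isFilter public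

SpecM : PavelkaAlgebra c ℓ → Set (lsuc (c ⊔ ℓ))
SpecM = MaximalFilter

quotient : (A : PavelkaAlgebra c ℓ) → SpecM A → RawPavelkaAlgebra c (c ⊔ ℓ)
quotient A F = record
  { Carrier = Carrier
  ; _≈_     = λ x y → mem (x ⇒ y) × mem (y ⇒ x)
  ; _⊕_     = _⊕_
  ; ∼_      = ∼_
  ; const   = const
  }
  where open PavelkaAlgebra A; open MaximalFilter F

record IsCongruence (M : RawMVAlgebra c ℓ) (θ : Rel (RawMVAlgebra.Carrier M) d) : Set (c ⊔ ℓ ⊔ d) where
  open RawMVAlgebra M
  field
    isEquivalence : IsEquivalence θ
    reflexive     : ∀ {x y} → x ≈ y → θ x y
    ⊕-compatible  : ∀ {x x′ y y′} → θ x x′ → θ y y′ → θ (x ⊕ y) (x′ ⊕ y′)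
    ∼-compatible  : ∀ {x y} → θ x y → θ (∼ x) (∼ y)

record IsSimple (M : MVAlgebra c ℓ) : Set (lsuc (c ⊔ ℓ)) where
  open MVAlgebra M
  field
    nontrivial : ¬ (0# ≈ 1#)
    congruence : (θ : Rel Carrier (c ⊔ ℓ)) → IsCongruence raw θ →
                 (∀ {x y} → θ x y → x ≈ y) ⊎ (∀ x y → θ x y)

-- The universe levels leave room for the canonical subdirect representation
-- of A, by its quotients A/F with F ranging over SpecM A.
record IsSemisimple (A : PavelkaAlgebra c ℓ) : Set (lsuc (lsuc (c ⊔ ℓ))) where
  private module A = PavelkaAlgebra A
  field
    Index         : Set (lsuc (c ⊔ ℓ))
    factor        : Index → MVAlgebra c (c ⊔ ℓ)
    factor-simple : ∀ k → IsSimple (factor k)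
    proj          : ∀ k → A.Carrier → MVAlgebra.Carrier (factor k)
    proj-homo     : ∀ k → IsMVHomomorphism A.rawMVAlgebra (MVAlgebra.raw (factor k)) (proj k)
    proj-onto     : ∀ k → Surjective A._≈_ (MVAlgebra._≈_ (factor k)) (proj k)
    separating    : ∀ {x y} → (∀ k → MVAlgebra._≈_ (factor k) (proj k x) (proj k y)) → x A.≈ y

record PavelkaAdjoint (A : PavelkaAlgebra a ℓ) (B : PavelkaAlgebra b ℓ′)
         (f : PavelkaAlgebra.Carrier A → PavelkaAlgebra.Carrier B)
         (g : PavelkaAlgebra.Carrier B → PavelkaAlgebra.Carrier A) : Set (a ⊔ b ⊔ ℓ ⊔ ℓ′) where
  private
    module A = PavelkaAlgebra A
    module B = PavelkaAlgebra B
  field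
    f-mono   : ∀ {x y} → x A.≤ y → f x B.≤ f y
    g-mono   : ∀ {x y} → x B.≤ y → g x A.≤ g y
    adjoint⇒ : ∀ {x y} → x B.≤ f y → g x A.≤ y
    adjoint⇐ : ∀ {x y} → g x A.≤ y → x B.≤ f y
    const-⇒  : ∀ r y → B.const r B.⇒ f y B.≈ f (A.const r A.⇒ y)

private
  shift< : ∀ {p q p′ q′} → q ℚ.- p ≡ q′ ℚ.- p′ → p ℚ.< q → p′ ℚ.< q′
  shift< {p} {q} {p′} {q′} e p<q = ≡.subst₂ ℚ._<_
    (solve 2 (λ p p′ → p :+ (p′ :- p) := p′) refl p p′)
    (≡.trans (solve 3 (λ p q p′ → q :+ (p′ :- p) := (q :- p) :+ p′) refl p q p′)
      (≡.trans (≡.cong (ℚ._+ p′) e) (solve 2 (λ p′ q′ → (q′ :- p′) :+ p′ := q′) refl p′ q′)))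
    (ℚ.+-monoˡ-< (p′ ℚ.- p) p<q)
    where open ℚ-Solver

  shift≤ : ∀ {p q p′ q′} → q ℚ.- p ≡ q′ ℚ.- p′ → p ℚ.≤ q → p′ ℚ.≤ q′
  shift≤ {p} {q} {p′} {q′} e p≤q = ≡.subst₂ ℚ._≤_
    (solve 2 (λ p p′ → p :+ (p′ :- p) := p′) refl p p′)
    (≡.trans (solve 3 (λ p q p′ → q :+ (p′ :- p) := (q :- p) :+ p′) refl p q p′)
      (≡.trans (≡.cong (ℚ._+ p′) e) (solve 2 (λ p′ q′ → (q′ :- p′) :+ p′ := q′) refl p′ q′)))
    (ℚ.+-monoˡ-≤ (p′ ℚ.- p) p≤q)
    where open ℚ-Solver

-- A real number is a proper nonempty down-set of rationals without greatest
-- element; L x q means q < x.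
record ℝ : Set₁ where
  field
    L         : ℚ → Set
    inhabited : ∃ λ q → L q
    bounded   : ∃ λ q → ¬ L q
    lower     : ∀ {p q} → p ℚ.< q → L q → L p
    rounded   : ∀ {q} → L q → ∃ λ r → q ℚ.< r × L r

  below : ∀ {p q} → L p → ¬ L q → p ℚ.< q
  below {p} {q} p∈ q∉ with ℚ.<-cmp p q
  ... | tri< p<q _ _ = p<q
  ... | tri≈ _ refl _ = ⊥-elim (q∉ p∈)
  ... | tri> _ _ q<p = ⊥-elim (q∉ (lower q<p p∈))

open ℝ

infix  4 _≤ʳ_ _≈ʳ_
infixl 6 _+ʳ_ _-ʳ_
infixl 7 _⊓ʳ_

_≤ʳ_ : Rel ℝ 0ℓ
x ≤ʳ y = ∀ {q} → L x q → L y q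

_≈ʳ_ : Rel ℝ 0ℓ
x ≈ʳ y = x ≤ʳ y × y ≤ʳ x

fromℚ : ℚ → ℝ
fromℚ s = record
  { L         = ℚ._< s
  ; inhabited = s ℚ.- 1ℚ , shift< (solve 1 (λ s → con 1ℚ :- con 0ℚ := s :- (s :- con 1ℚ)) refl s) (ℚ.positive⁻¹ 1ℚ)
  ; bounded   = s , ℚ.<-irrefl refl
  ; lower     = ℚ.<-trans
  ; rounded   = ℚ.<-dense
  }
  where open ℚ-Solver

_+ʳ_ : ℝ → ℝ → ℝ
x +ʳ y = record
  { L         = λ p → ∃ λ s → ∃ λ t → L x s × L y t × p ≡ s ℚ.+ t
  ; inhabited = _ , _ , _ , proj₂ (inhabited x) , proj₂ (inhabited y) , refl
  ; bounded   = let (u , u∉) = bounded x ; (v , v∉) = bounded y in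
      u ℚ.+ v , λ (_ , _ , s∈ , t∈ , e) →
        ℚ.<-irrefl (≡.sym e) (ℚ.+-mono-< (below x s∈ u∉) (below y t∈ v∉))
  ; lower     = λ { {p} p<q (s , t , s∈ , t∈ , refl) →
      p ℚ.- t , t ,
      lower x (shift< (solve 3 (λ p s t → (s :+ t) :- p := s :- (p :- t)) refl p s t) p<q) s∈ ,
      t∈ , solve 2 (λ p t → p := (p :- t) :+ t) refl p t }
  ; rounded   = λ { (s , t , s∈ , t∈ , refl) → let (s′ , s<s′ , s′∈) = rounded x s∈ in
      s′ ℚ.+ t , ℚ.+-monoˡ-< t s<s′ , s′ , t , s′∈ , t∈ , refl }
  }
  where open ℚ-Solver

-- ¬ L y t means y ≤ t, so these s - t are the rationals below x - y.
_-ʳ_ : ℝ → ℝ → ℝ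
x -ʳ y = record
  { L         = λ p → ∃ λ s → ∃ λ t → L x s × ¬ L y t × p ≡ s ℚ.- t
  ; inhabited = _ , _ , _ , proj₂ (inhabited x) , proj₂ (bounded y) , refl
  ; bounded   = let (u , u∉) = bounded x ; (v , v∈) = inhabited y in
      u ℚ.- v , λ (_ , _ , s∈ , t∉ , e) →
        ℚ.<-irrefl (≡.sym e) (ℚ.+-mono-< (below x s∈ u∉) (ℚ.neg-antimono-< (below y v∈ t∉)))
  ; lower     = λ { {p} p<q (s , t , s∈ , t∉ , refl) →
      p ℚ.+ t , t ,
      lower x (shift< (solve 3 (λ p s t → (s :- t) :- p := s :- (p :+ t)) refl p s t) p<q) s∈ ,
      t∉ , solve 2 (λ p t → p := (p :+ t) :- t) refl p t }
  ; rounded   = λ { (s , t , s∈ , t∉ , refl) → let (s′ , s<s′ , s′∈) = rounded x s∈ in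
      s′ ℚ.- t , ℚ.+-monoˡ-< (ℚ.- t) s<s′ , s′ , t , s′∈ , t∉ , refl }
  }
  where open ℚ-Solver

_⊓ʳ_ : ℝ → ℝ → ℝ
x ⊓ʳ y = record
  { L         = λ p → L x p × L y p
  ; inhabited = let (u , u∈) = inhabited x ; (v , v∈) = inhabited y in common u u∈ v v∈ (ℚ.<-cmp u v)
  ; bounded   = let (u , u∉) = bounded x in u , λ (u∈ , _) → u∉ u∈
  ; lower     = λ p<q (q∈x , q∈y) → lower x p<q q∈x , lower y p<q q∈y
  ; rounded   = λ (q∈x , q∈y) →
      let (u , q<u , u∈) = rounded x q∈x ; (v , q<v , v∈) = rounded y q∈y
          (w , w∈x , w∈y , c) = common′ u u∈ v v∈ (ℚ.<-cmp u v)
      in  w , pick q<u q<v c , w∈x , w∈y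
  }
  where
  common′ : ∀ u → L x u → ∀ v → L y v → Tri (u ℚ.< v) (u ≡ v) (v ℚ.< u) →
         ∃ λ w → L x w × L y w × (w ≡ u ⊎ w ≡ v)
  common′ u u∈ v v∈ (tri< u<v _ _)  = u , u∈ , lower y u<v v∈ , inj₁ refl
  common′ u u∈ v v∈ (tri≈ _ refl _) = u , u∈ , v∈ , inj₁ refl
  common′ u u∈ v v∈ (tri> _ _ v<u)  = v , lower x v<u u∈ , v∈ , inj₂ refl
  common : ∀ u → L x u → ∀ v → L y v → Tri (u ℚ.< v) (u ≡ v) (v ℚ.< u) →
        ∃ λ w → L x w × L y w
  common u u∈ v v∈ t = let (w , w∈x , w∈y , _) = common′ u u∈ v v∈ t in w , w∈x , w∈y
  pick : ∀ {q u v w} → q ℚ.< u → q ℚ.< v → (w ≡ u ⊎ w ≡ v) → q ℚ.< w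
  pick q<u q<v (inj₁ refl) = q<u
  pick q<u q<v (inj₂ refl) = q<v

0ʳ 1ʳ : ℝ
0ʳ = fromℚ 0ℚ
1ʳ = fromℚ 1ℚ

record 𝕀 : Set₁ where
  constructor mk𝕀
  field
    real : ℝ
    0≤   : 0ʳ ≤ʳ real
    ≤1   : real ≤ʳ 1ʳ

  ∉⇒0≤ : ∀ {q} → ¬ L real q → 0ℚ ℚ.≤ q
  ∉⇒0≤ q∉ = ℚ.≮⇒≥ (q∉ ∘ 0≤)

open 𝕀

standard : RawPavelkaAlgebra (lsuc 0ℓ) 0ℓ
standard = record
  { Carrier = 𝕀
  ; _≈_     = λ x y → real x ≈ʳ real y
  ; _⊕_     = λ x y → mk𝕀 ((real x +ʳ real y) ⊓ʳ 1ʳ)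
      (λ {q} q<0 → (half q ,  half q , 0≤ x (half<0 q<0) , 0≤ y (half<0 q<0) , half+half q)
                 , ℚ.<-trans q<0 (ℚ.positive⁻¹ 1ℚ))
      proj₂
  ; ∼_      = λ x → mk𝕀 (1ʳ -ʳ real x)
      (λ {q} q<0 → q ℚ.+ 1ℚ , 1ℚ ,
        shift< (solve 1 (λ q → con 0ℚ :- q := con 1ℚ :- (q :+ con 1ℚ)) refl q) q<0 ,
        (λ 1∈ → ℚ.<-irrefl refl (≤1 x 1∈)) ,
        solve 1 (λ q → q := (q :+ con 1ℚ) :- con 1ℚ) refl q)
      (λ { (s , t , s<1 , t∉ , refl) →
        shift< (solve 2 (λ s t → (con 1ℚ :+ t) :- (s :+ con 0ℚ) := con 1ℚ :- (s :- t)) refl s t)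
               (ℚ.+-mono-<-≤ s<1 (∉⇒0≤ x t∉)) })
  ; const   = λ r → mk𝕀 (fromℚ (val r))
      (λ q<0 → ℚ.<-≤-trans q<0 (0≤val r))
      (λ q<r → ℚ.<-≤-trans q<r (val≤1 r))
  }
  where
  open ℚ-Solver
  half : ℚ → ℚ
  half q = ℚ.½ ℚ.* q
  half+half : ∀ q → q ≡ half q ℚ.+ half q
  half+half = solve 1 (λ q → q := con ℚ.½ :* q :+ con ℚ.½ :* q) refl
  half<0 : ∀ {q} → q ℚ.< 0ℚ → half q ℚ.< 0ℚ
  half<0 q<0 = ℚ.*-monoʳ-<-pos ℚ.½ q<0

module Std = RawPavelkaAlgebra standard

infix 4 _≤ᴵ_
_≤ᴵ_ : Rel 𝕀 0ℓ
x ≤ᴵ y = real x ≤ʳ real y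

ZeroOneValued : {I : Set a} {J : Set b} → (I → J → 𝕀) → Set (a ⊔ b)
ZeroOneValued R = ∀ i j → R i j Std.≈ Std.0# ⊎ R i j Std.≈ Std.1#

private
  ⊕-congᴵ : ∀ {x x′ y y′} → x ≤ᴵ x′ → y ≤ᴵ y′ → (x Std.⊕ y) ≤ᴵ (x′ Std.⊕ y′)
  ⊕-congᴵ x≤ y≤ ((s , t , s∈ , t∈ , e) , q<1) = (s , t , x≤ s∈ , y≤ t∈ , e) , q<1

  ∼-antiᴵ : ∀ {x y} → x ≤ᴵ y → (Std.∼ y) ≤ᴵ (Std.∼ x)
  ∼-antiᴵ x≤y (s , t , s<1 , t∉ , e) = s , t , s<1 , t∉ ∘ x≤y , e

  ⇒-top : ∀ x y → Std.const 1₀₁ ≤ᴵ (x Std.⇒ y) → x ≤ᴵ y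
  ⇒-top x y top {q} q∈ =
    let (r , q<r , r∈) = rounded (real x) q∈
        ((u , v , (s , t , s<1 , t∉ , u≡) , v∈ , e) , _) = top (1-gap<1 q<r)
    in lower (real y) (step u≡ e s<1 (below (real x) r∈ t∉)) v∈
    where
    open ℚ-Solver
    1-gap<1 : ∀ {r} → q ℚ.< r → 1ℚ ℚ.- (r ℚ.- q) ℚ.< 1ℚ
    1-gap<1 {r} = shift< (solve 2 (λ q r → r :- q := con 1ℚ :- (con 1ℚ :- (r :- q))) refl q r)
    step : ∀ {r u v s t} → u ≡ s ℚ.- t → 1ℚ ℚ.- (r ℚ.- q) ≡ u ℚ.+ v → s ℚ.< 1ℚ → r ℚ.< t → q ℚ.< v
    step {r} {u} {v} {s} {t} refl e s<1 r<t = shift<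
      (≡.trans (solve 4 (λ q r s t → (con 1ℚ :+ t) :- (s :+ r) :=
                  (con 1ℚ :- (r :- q)) :- ((s :- t) :+ q)) refl q r s t)
        (≡.trans (≡.cong (ℚ._- ((s ℚ.- t) ℚ.+ q)) e)
          (solve 4 (λ q v s t → ((s :- t) :+ v) :- ((s :- t) :+ q) := v :- q) refl q v s t)))
      (ℚ.+-mono-< s<1 r<t)

private
  infixr 7 _×ℚ_
  _×ℚ_ : ℕ → ℚ → ℚ
  zero  ×ℚ p = 0ℚ
  suc n ×ℚ p = p ℚ.+ n ×ℚ p

  ×ℚ-toℚᵘ : ∀ n p → toℚᵘ (n ×ℚ p) ℚᵘ.≃ ℚᵘ.mkℚᵘ (ℤ.+ n ℤ.* ℚ.↥ p) (ℚ.denominator-1 p)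
  ×ℚ-toℚᵘ zero p = ℚᵘ.*≡* refl
  ×ℚ-toℚᵘ (suc n) p@(mkℚ u v _) =
    ℚᵘ.≃-trans (ℚ.toℚᵘ-homo-+ p (n ×ℚ p))
   (ℚᵘ.≃-trans (ℚᵘ.+-cong {x = toℚᵘ p} {u = toℚᵘ (n ×ℚ p)} ℚᵘ.≃-refl (×ℚ-toℚᵘ n p))
    (ℚᵘ.*≡* (≡.trans
      (solve 3 (λ m u w → (u :* w :+ (m :* u) :* w) :* w := ((con ℤ.1ℤ :+ m) :* u) :* (w :* w)) refl (ℤ.+ n) u (ℤ.+ suc v))
      (≡.cong ((ℤ.+ suc n ℤ.* u) ℤ.*_) (≡.sym (ℤ.pos-* (suc v) (suc v)))))))
    where open ℤ-Solver

  archimedean : ∀ {ε} → 0ℚ ℚ.< ε → ∃ λ n → 1ℚ ℚ.≤ n ×ℚ ε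
  archimedean {ε@(mkℚ ℤ.+[1+ u ] v _)} _ = suc v , ℚ.toℚᵘ-cancel-≤
    (ℚᵘ.≤-respʳ-≃ (ℚᵘ.≃-sym (×ℚ-toℚᵘ (suc v) ε)) (ℚᵘ.*≤* (ℤ.+≤+ (begin
      1 ℕ.* suc v             ≡⟨ ℕ.*-comm 1 (suc v) ⟩
      suc v ℕ.* 1             ≤⟨ ℕ.*-monoʳ-≤ (suc v) (ℕ.s≤s ℕ.z≤n) ⟩
      suc v ℕ.* suc u         ≡⟨ ℕ.*-identityʳ _ ⟨
      suc v ℕ.* suc u ℕ.* 1   ∎))))
    where open ℕ.≤-Reasoning
  archimedean {mkℚ (ℤ.+ 0) v _} (ℚ.*<* (ℤ.+<+ ()))
  archimedean {mkℚ ℤ.-[1+ u ] v _} (ℚ.*<* ())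

  -- 1/(1+n)
  recip : ℕ → ℚ
  recip n = mkℚ (ℤ.+ 1) n (ℕ.1-coprimeTo (suc n))

  0<recip : ∀ n → 0ℚ ℚ.< recip n
  0<recip n = ℚ.positive⁻¹ (recip n)

  recip≤1 : ∀ n → recip n ℚ.≤ 1ℚ
  recip≤1 n = ℚ.*≤* (ℤ.+≤+ (ℕ.s≤s ℕ.z≤n))

  ×recip : ∀ n → suc n ×ℚ recip n ≡ 1ℚ
  ×recip n = ℚ.toℚᵘ-injective (ℚᵘ.≃-trans (×ℚ-toℚᵘ (suc n) (recip n))
    (ℚᵘ.*≡* (solve 1 (λ m → (m :* con ℤ.1ℤ) :* con ℤ.1ℤ := con ℤ.1ℤ :* m) refl (ℤ.+ suc n))))
    where open ℤ-Solver

  halve : ∀ {δ} → 0ℚ ℚ.< δ → ∃ λ η → 0ℚ ℚ.< η × η ℚ.+ η ≡ δ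
  halve {δ} 0<δ = ℚ.½ ℚ.* δ , ℚ.*-monoʳ-<-pos ℚ.½ 0<δ ,
    solve 1 (λ δ → con ℚ.½ :* δ :+ con ℚ.½ :* δ := δ) refl δ
    where open ℚ-Solver

  add-gaps : ∀ {r s r′ s′ η δ} → s ℚ.≤ r ℚ.+ η → r ℚ.≤ s′ → s′ ℚ.≤ r′ ℚ.+ η → η ℚ.+ η ≡ δ →
             s ℚ.≤ r′ ℚ.+ δ
  add-gaps {r} {s} {r′} {s′} {η} s≤ r≤ s′≤ refl =
    subst (s ℚ.≤_) (ℚ.+-assoc r′ η η) (ℚ.≤-trans s≤ (ℚ.+-monoˡ-≤ η (ℚ.≤-trans r≤ s′≤)))

  minus-bound : ∀ {s r δ} → s ℚ.≤ r ℚ.+ δ → 0ℚ ℚ.≤ δ →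
                1ℚ ℚ.- (((1ℚ ℚ.- s) ℚ.+ r) ℚ.⊓ 1ℚ) ℚ.≤ δ
  minus-bound {s} {r} {δ} s≤ 0≤δ with ℚ.≤-total ((1ℚ ℚ.- s) ℚ.+ r) 1ℚ
  ... | inj₁ ≤1 = subst (λ m → 1ℚ ℚ.- m ℚ.≤ δ) (≡.sym (ℚ.p≤q⇒p⊓q≡p ≤1))
        (shift≤ (solve 3 (λ s r δ → (r :+ δ) :- s := δ :- (con 1ℚ :- ((con 1ℚ :- s) :+ r))) refl s r δ) s≤)
    where open ℚ-Solver
  ... | inj₂ 1≤ = subst (λ m → 1ℚ ℚ.- m ℚ.≤ δ) (≡.sym (ℚ.p≥q⇒p⊓q≡q 1≤)) 0≤δ

  split-gap : ∀ {q r} → q ℚ.< r → ∃ λ η → 0ℚ ℚ.< η × q ℚ.+ (η ℚ.+ η) ℚ.< r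
  split-gap {q} {r} q<r =
    let (m , q<m , m<r) = ℚ.<-dense q<r
        (η , 0<η , e)   = halve (shift< (solve 2 (λ q m → m :- q := (m :- q) :- con 0ℚ) refl q m) q<m)
    in η , 0<η , subst (ℚ._< r) (≡.trans (solve 2 (λ q m → m := q :+ (m :- q)) refl q m) (≡.cong (q ℚ.+_) (≡.sym e))) m<r
    where open ℚ-Solver

  remainder : ∀ {q r η u v s t} → q ℚ.+ (η ℚ.+ η) ℚ.< r → r ℚ.≤ (s ℚ.+ t) ℚ.⊓ 1ℚ →
              s ℚ.≤ u ℚ.+ η → t ℚ.≤ v ℚ.+ η → q ℚ.- v ℚ.< u
  remainder {q} {r} {η} {u} {v} {s} {t} gap r≤ s≤ t≤ = shift<
    (solve 4 (λ q η u v → ((u :+ η) :+ (v :+ η)) :- (q :+ (η :+ η)) := u :- (q :- v)) refl q η u v)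
    (ℚ.<-≤-trans gap (ℚ.≤-trans r≤ (ℚ.≤-trans (ℚ.p⊓q≤p (s ℚ.+ t) 1ℚ) (ℚ.+-mono-≤ s≤ t≤))))
    where open ℚ-Solver

  swap-minus : ∀ {q v m} → q ℚ.- v ℚ.< m → q ℚ.- m ℚ.< v
  swap-minus {q} {v} {m} = shift< (solve 3 (λ q v m → m :- (q :- v) := v :- (q :- m)) refl q v m)
    where open ℚ-Solver

  add-minus : ∀ q m → q ≡ m ℚ.+ (q ℚ.- m)
  add-minus = solve 2 (λ q m → q := m :+ (q :- m)) refl
    where open ℚ-Solver

  <-⊓ : ∀ {p q r} → p ℚ.< q → p ℚ.< r → p ℚ.< q ℚ.⊓ r
  <-⊓ {p} {q} {r} p<q p<r with ℚ.≤-total q r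
  ... | inj₁ q≤r = subst (p ℚ.<_) (≡.sym (ℚ.p≤q⇒p⊓q≡p q≤r)) p<q
  ... | inj₂ r≤q = subst (p ℚ.<_) (≡.sym (ℚ.p≥q⇒p⊓q≡q r≤q)) p<r

  compl : ℚ₀₁ → ℚ₀₁
  compl r = mkℚ₀₁ (1ℚ ℚ.- val r)
    (shift≤ (solve 1 (λ r → con 1ℚ :- r := (con 1ℚ :- r) :- con 0ℚ) refl (val r)) (val≤1 r))
    (shift≤ (solve 1 (λ r → r :- con 0ℚ := con 1ℚ :- (con 1ℚ :- r)) refl (val r)) (0≤val r))
    where open ℚ-Solver

  plus : ℚ₀₁ → ℚ₀₁ → ℚ₀₁
  plus r s = mkℚ₀₁ ((val r ℚ.+ val s) ℚ.⊓ 1ℚ)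
    (ℚ.⊓-glb (ℚ.+-mono-≤ (0≤val r) (0≤val s)) (ℚ.nonNegative⁻¹ 1ℚ))
    (ℚ.p⊓q≤q (val r ℚ.+ val s) 1ℚ)

module _ (A : PavelkaAlgebra c ℓ) where
  open PavelkaAlgebra A
  private
    module ⊕ = IsCommutativeMonoid ⊕-isCommutativeMonoid
    ⊕-commutativeMonoid : CommutativeMonoid c ℓ
    ⊕-commutativeMonoid = record { isCommutativeMonoid = ⊕-isCommutativeMonoid }
    module CS = CommutativeSemigroupProperties (CommutativeMonoid.commutativeSemigroup ⊕-commutativeMonoid)
    open SetoidReasoning ⊕.setoid

    ⊕-congˡ : ∀ {x y z} → y ≈ z → x ⊕ y ≈ x ⊕ z
    ⊕-congˡ = ⊕.∙-cong ⊕.refl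
    ⊕-congʳ : ∀ {x y z} → y ≈ z → y ⊕ x ≈ z ⊕ x
    ⊕-congʳ e = ⊕.∙-cong e ⊕.refl

    ⊕-zeroˡ : ∀ x → 1# ⊕ x ≈ 1#
    ⊕-zeroˡ x = ⊕.trans (⊕.comm _ _) (⊕-zeroʳ x)

    ∼1≈0 : ∼ 1# ≈ 0#
    ∼1≈0 = ∼-involutive 0#

    ∼x⊕x : ∀ x → ∼ x ⊕ x ≈ 1#
    ∼x⊕x x = begin
      ∼ x ⊕ x             ≈⟨ ⊕-congʳ (∼-cong (⊕.identityˡ x)) ⟨
      ∼ (0# ⊕ x) ⊕ x      ≈⟨ ⊕-congʳ (∼-cong (⊕-congʳ ∼1≈0)) ⟨
      ∼ (∼ 1# ⊕ x) ⊕ x    ≈⟨ łukasiewicz x 1# ⟨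
      ∼ (∼ x ⊕ 1#) ⊕ 1#   ≈⟨ ⊕-zeroʳ _ ⟩
      1#                  ∎

    x⊕∼x : ∀ x → x ⊕ ∼ x ≈ 1#
    x⊕∼x x = ⊕.trans (⊕.comm _ _) (∼x⊕x x)

    absorb : ∀ {x} y → x ≈ 1# → x ⊕ y ≈ 1#
    absorb y e = ⊕.trans (⊕-congʳ e) (⊕-zeroˡ y)

    ≤-⊕ʳ : ∀ x z → x ≤ x ⊕ z
    ≤-⊕ʳ x z = ⊕.trans (⊕.sym (⊕.assoc _ _ _)) (absorb z (∼x⊕x x))

    ≈⇒≤ : ∀ {x y} → x ≈ y → x ≤ y
    ≈⇒≤ {x} e = ⊕.trans (⊕-congˡ (⊕.sym e)) (∼x⊕x x)

    swap-łukasiewicz : ∀ p q → p ⊕ ∼ (p ⊕ q) ≈ ∼ q ⊕ ∼ (∼ q ⊕ ∼ p)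
    swap-łukasiewicz p q = begin
      p ⊕ ∼ (p ⊕ q)             ≈⟨ ⊕.comm _ _ ⟩
      ∼ (p ⊕ q) ⊕ p             ≈⟨ ⊕-congʳ (∼-cong (⊕.comm p q)) ⟩
      ∼ (q ⊕ p) ⊕ p             ≈⟨ ⊕-congʳ (∼-cong (⊕-congʳ (∼-involutive q))) ⟨
      ∼ (∼ ∼ q ⊕ p) ⊕ p         ≈⟨ łukasiewicz (∼ q) p ⟩
      ∼ (∼ p ⊕ ∼ q) ⊕ ∼ q       ≈⟨ ⊕.comm _ _ ⟩
      ∼ q ⊕ ∼ (∼ p ⊕ ∼ q)       ≈⟨ ⊕-congˡ (∼-cong (⊕.comm _ _)) ⟩
      ∼ q ⊕ ∼ (∼ q ⊕ ∼ p)       ∎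

    -- (a ⇒ b) ≤ b for a = x ⇒ y and b = y ⇒ x
    prelinear : ∀ x y → ∼ (∼ (x ⇒ y) ⊕ (y ⇒ x)) ⊕ (y ⇒ x) ≈ 1#
    prelinear x y = begin
      ∼ (∼ (x ⇒ y) ⊕ β) ⊕ β                        ≈⟨ łukasiewicz (x ⇒ y) β ⟩
      ∼ (∼ β ⊕ (∼ x ⊕ y)) ⊕ (∼ x ⊕ y)              ≈⟨ ⊕.comm _ _ ⟩
      (∼ x ⊕ y) ⊕ ∼ (∼ β ⊕ (∼ x ⊕ y))              ≈⟨ ⊕.assoc _ _ _ ⟩
      ∼ x ⊕ (y ⊕ ∼ (∼ β ⊕ (∼ x ⊕ y)))              ≈⟨ ⊕-congˡ (⊕-congˡ (∼-cong (CS.x∙yz≈z∙yx _ _ _))) ⟩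
      ∼ x ⊕ (y ⊕ ∼ (y ⊕ e))                        ≈⟨ ⊕-congˡ (swap-łukasiewicz y e) ⟩
      ∼ x ⊕ (∼ e ⊕ ∼ (∼ e ⊕ ∼ y))                  ≈⟨ ⊕.assoc _ _ _ ⟨
      (∼ x ⊕ ∼ (∼ x ⊕ ∼ β)) ⊕ ∼ (∼ e ⊕ ∼ y)        ≈⟨ ⊕-congʳ (swap-łukasiewicz (∼ x) (∼ β)) ⟩
      (∼ ∼ β ⊕ w) ⊕ ∼ (∼ e ⊕ ∼ y)                  ≈⟨ ⊕-congʳ (⊕-congʳ (∼-involutive β)) ⟩
      ((∼ y ⊕ x) ⊕ w) ⊕ ∼ (∼ e ⊕ ∼ y)              ≈⟨ ⊕-congˡ (∼-cong (⊕.comm _ _)) ⟩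
      ((∼ y ⊕ x) ⊕ w) ⊕ z                          ≈⟨ ⊕-congʳ (⊕.comm _ _) ⟩
      (w ⊕ (∼ y ⊕ x)) ⊕ z                          ≈⟨ ⊕-congʳ (⊕-congˡ (⊕.comm _ _)) ⟩
      (w ⊕ (x ⊕ ∼ y)) ⊕ z                          ≈⟨ ⊕-congʳ (⊕.assoc _ _ _) ⟨
      ((w ⊕ x) ⊕ ∼ y) ⊕ z                          ≈⟨ ⊕.assoc _ _ _ ⟩
      (w ⊕ x) ⊕ (∼ y ⊕ z)                          ≈⟨ ⊕-congˡ (swap-łukasiewicz (∼ y) (∼ e)) ⟩
      (w ⊕ x) ⊕ (∼ ∼ e ⊕ z′)                       ≈⟨ ⊕-congˡ (⊕-congʳ (∼-involutive e)) ⟩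
      (w ⊕ x) ⊕ ((∼ x ⊕ ∼ β) ⊕ z′)                 ≈⟨ ⊕.assoc _ _ _ ⟩
      w ⊕ (x ⊕ ((∼ x ⊕ ∼ β) ⊕ z′))                 ≈⟨ ⊕-congˡ (⊕-congˡ (⊕.assoc _ _ _)) ⟩
      w ⊕ (x ⊕ (∼ x ⊕ (∼ β ⊕ z′)))                 ≈⟨ ⊕-congˡ (⊕.assoc _ _ _) ⟨
      w ⊕ ((x ⊕ ∼ x) ⊕ (∼ β ⊕ z′))                 ≈⟨ ⊕-congˡ (absorb _ (x⊕∼x x)) ⟩
      w ⊕ 1#                                       ≈⟨ ⊕-zeroʳ w ⟩
      1#                                           ∎
      where
      β  = y ⇒ x
      e  = ∼ x ⊕ ∼ β
      w  = ∼ (∼ ∼ β ⊕ ∼ ∼ x)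
      z  = ∼ (∼ y ⊕ ∼ e)
      z′ = ∼ (∼ ∼ e ⊕ ∼ ∼ y)

    ∼const : ∀ r → ∼ const r ≈ const (compl r)
    ∼const r = const-∼ r (compl r) refl

    const-1 : 1# ≈ const 1₀₁
    const-1 = const-∼ 0₀₁ 1₀₁ refl

    const-mono : ∀ {r s} → val r ℚ.≤ val s → const r ≤ const s
    const-mono {r} {s} r≤s = begin
      ∼ const r ⊕ const s          ≈⟨ ⊕-congʳ (∼const r) ⟩
      const (compl r) ⊕ const s    ≈⟨ const-⊕ (compl r) s 1₀₁ (ℚ.p≥q⇒p⊓q≡q {val (compl r) ℚ.+ val s} {1ℚ}
        (shift≤ (solve 2 (λ r s → s :- r := ((con 1ℚ :- r) :+ s) :- con 1ℚ) refl (val r) (val s)) r≤s)) ⟩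
      const 1₀₁                    ≈⟨ const-1 ⟨
      1#                           ∎
      where open ℚ-Solver

    multiple : ℕ → Carrier → Carrier
    multiple zero    x = 0#
    multiple (suc n) x = x ⊕ multiple n x

    multiple-+ : ∀ m n x → multiple (m ℕ.+ n) x ≈ multiple m x ⊕ multiple n x
    multiple-+ zero    n x = ⊕.sym (⊕.identityˡ _)
    multiple-+ (suc m) n x = ⊕.trans (⊕-congˡ (multiple-+ m n x)) (⊕.sym (⊕.assoc _ _ _))

  module _ (em : ∀ {ℓ} → ExcludedMiddle ℓ) (F : SpecM A) where
    open MaximalFilter F
    private
      infix 4 _≼_
      _≼_ : Rel Carrier (c ⊔ ℓ)
      x ≼ y = mem (x ⇒ y)

      ∈-resp : ∀ {x y} → x ≈ y → mem x → mem y
      ∈-resp = ≤-closed ∘ ≈⇒≤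

      ∈-1 : ∀ {x} → x ≈ 1# → mem x
      ∈-1 e = ∈-resp (⊕.sym e) 1∈

      mp : ∀ {x y} → mem x → x ≼ y → mem y
      mp {x} {y} x∈ x≼y = ≤-closed lemma (·-closed x∈ x≼y)
        where
        lemma : x · (x ⇒ y) ≤ y
        lemma = begin
          ∼ ∼ (∼ x ⊕ ∼ (∼ x ⊕ y)) ⊕ y   ≈⟨ ⊕-congʳ (∼-involutive _) ⟩
          (∼ x ⊕ ∼ (∼ x ⊕ y)) ⊕ y       ≈⟨ CS.xy∙z≈xz∙y _ _ _ ⟩
          (∼ x ⊕ y) ⊕ ∼ (∼ x ⊕ y)       ≈⟨ x⊕∼x _ ⟩
          1#                            ∎

      ≼-refl : ∀ {x y} → x ≈ y → x ≼ y
      ≼-refl = ∈-1 ∘ ≈⇒≤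

      ≼-trans : ∀ {x y z} → x ≼ y → y ≼ z → x ≼ z
      ≼-trans {x} {y} {z} x≼y y≼z = mp y≼z (mp x≼y (∈-1 (begin
        ∼ (∼ x ⊕ y) ⊕ (∼ (∼ y ⊕ z) ⊕ (∼ x ⊕ z))     ≈⟨ ⊕-congˡ (CS.x∙yz≈y∙xz _ _ _) ⟩
        ∼ (∼ x ⊕ y) ⊕ (∼ x ⊕ (∼ (∼ y ⊕ z) ⊕ z))     ≈⟨ ⊕-congˡ (⊕-congˡ (łukasiewicz y z)) ⟩
        ∼ (∼ x ⊕ y) ⊕ (∼ x ⊕ (∼ (∼ z ⊕ y) ⊕ y))     ≈⟨ ⊕-congˡ (CS.x∙yz≈xz∙y _ _ _) ⟩
        ∼ (∼ x ⊕ y) ⊕ ((∼ x ⊕ y) ⊕ ∼ (∼ z ⊕ y))     ≈⟨ ⊕.assoc _ _ _ ⟨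
        (∼ (∼ x ⊕ y) ⊕ (∼ x ⊕ y)) ⊕ ∼ (∼ z ⊕ y)     ≈⟨ absorb _ (∼x⊕x _) ⟩
        1#                                          ∎)))

      ∼-anti : ∀ {x y} → x ≼ y → ∼ y ≼ ∼ x
      ∼-anti {x} {y} = ∈-resp (begin
        ∼ x ⊕ y         ≈⟨ ⊕.comm _ _ ⟩
        y ⊕ ∼ x         ≈⟨ ⊕-congʳ (∼-involutive y) ⟨
        ∼ ∼ y ⊕ ∼ x     ∎)

      ⊕-monoˡ : ∀ {x y} z → x ≼ y → x ⊕ z ≼ y ⊕ z
      ⊕-monoˡ {x} {y} z x≼y = mp x≼y (∈-1 (begin
        ∼ (∼ x ⊕ y) ⊕ (∼ (x ⊕ z) ⊕ (y ⊕ z))          ≈⟨ CS.x∙yz≈y∙xz _ _ _ ⟩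
        ∼ (x ⊕ z) ⊕ (∼ (∼ x ⊕ y) ⊕ (y ⊕ z))          ≈⟨ ⊕-congˡ (⊕.assoc _ _ _) ⟨
        ∼ (x ⊕ z) ⊕ ((∼ (∼ x ⊕ y) ⊕ y) ⊕ z)          ≈⟨ ⊕-congˡ (⊕-congʳ (łukasiewicz x y)) ⟩
        ∼ (x ⊕ z) ⊕ ((∼ (∼ y ⊕ x) ⊕ x) ⊕ z)          ≈⟨ ⊕-congˡ (CS.xy∙z≈yz∙x _ _ _) ⟩
        ∼ (x ⊕ z) ⊕ ((x ⊕ z) ⊕ ∼ (∼ y ⊕ x))          ≈⟨ ≤-⊕ʳ _ _ ⟩
        1#                                           ∎))

      ⊕-monoʳ : ∀ {x y} z → x ≼ y → z ⊕ x ≼ z ⊕ y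
      ⊕-monoʳ z x≼y = ≼-trans (≼-refl (⊕.comm _ _)) (≼-trans (⊕-monoˡ z x≼y) (≼-refl (⊕.comm _ _)))

      ⊕-mono : ∀ {x y x′ y′} → x ≼ x′ → y ≼ y′ → x ⊕ y ≼ x′ ⊕ y′
      ⊕-mono p q = ≼-trans (⊕-monoˡ _ p) (⊕-monoʳ _ q)

      0≼ : ∀ x → 0# ≼ x
      0≼ x = ∈-1 (⊕-zeroˡ x)

      ≼1 : ∀ x → x ≼ 1#
      ≼1 x = ∈-1 (⊕-zeroʳ _)

      -- otherwise F and x generate a proper filter
      generated : ∀ {x} → ¬ mem x → ∃ λ n → mem (multiple n (∼ x))
      generated {x} x∉ with em {P = ∃ λ n → mem (multiple n (∼ x))}
      ... | yes p = p
      ... | no ¬p = ⊥-elim (x∉ (maximal G G-filter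
              (λ (n , p) → ¬p (n , ∈-resp (⊕.identityʳ _) p))
              (λ z∈ → 0 , ∈-resp (⊕.sym (⊕.identityˡ _)) z∈)
              (1 , ∈-1 (⊕.trans (⊕-congʳ (⊕.identityʳ _)) (∼x⊕x x)))))
        where
        M : ℕ → Carrier
        M n = multiple n (∼ x)
        G : Carrier → Set (c ⊔ ℓ)
        G z = Σ ℕ λ n → mem (M n ⊕ z)
        G-filter : IsFilter rawMVAlgebra G
        G-filter = record
          { 1∈       = 0 , ∈-1 (⊕-zeroʳ _)
          ; ·-closed = λ { {y} {z} (m , p) (n , q) → m ℕ.+ n ,
              mp q (≼-trans (⊕-monoʳ (M n) (∈-resp (closed-eq m y z)
                  (mp p (⊕-monoʳ (M m) (∈-1 (pairing y z))))))
                (≼-refl (⊕.trans (CS.x∙yz≈yx∙z _ _ _) (⊕-congʳ (⊕.sym (multiple-+ m n (∼ x))))))) }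
          ; ≤-closed = λ y≤z (n , p) → n , mp p (⊕-monoʳ (M n) (∈-1 y≤z))
          }
          where
          pairing : ∀ y z → y ≤ (z ⇒ y · z)
          pairing y z = ⊕.trans (⊕.sym (⊕.assoc _ _ _)) (x⊕∼x _)
          closed-eq : ∀ m y z → M m ⊕ (z ⇒ y · z) ≈ z ⇒ (M m ⊕ y · z)
          closed-eq m y z = CS.x∙yz≈y∙xz _ _ _

      ≼-total : ∀ x y → x ≼ y ⊎ y ≼ x
      ≼-total x y with em {P = x ≼ y}
      ... | yes p = inj₁ p
      ... | no ¬p = let (n , q) = generated ¬p in
              inj₂ (mp (≤-closed (≤-⊕ʳ _ _) q) (absorbs n))
        where
        absorbs : ∀ n → multiple n (∼ (x ⇒ y)) ⊕ (y ⇒ x) ≼ (y ⇒ x)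
        absorbs zero    = ≼-refl (⊕.identityˡ _)
        absorbs (suc n) = ≼-trans (≼-refl (⊕.assoc _ _ _))
          (≼-trans (⊕-monoʳ _ (absorbs n)) (∈-1 (prelinear x y)))

      const≼ : ∀ {r s} → val r ℚ.≤ val s → const r ≼ const s
      const≼ {r} {s} = ∈-1 ∘ const-mono {r} {s}

      const∈⇒1≤ : ∀ t → mem (const t) → 1ℚ ℚ.≤ val t
      const∈⇒1≤ t t∈ = ℚ.≮⇒≥ λ t<1 →
        let (n , 1≤nε) = archimedean (0<ε t<1) in descend n t t∈ (ℚ.≤-trans (val≤1 t) 1≤nε)
        where
        open ℚ-Solver
        ε : ℚ
        ε = 1ℚ ℚ.- val t
        0<ε : val t ℚ.< 1ℚ → 0ℚ ℚ.< ε
        0<ε = shift< (solve 1 (λ t → con 1ℚ :- t := (con 1ℚ :- t) :- con 0ℚ) refl (val t))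
        ≤0⇒⊥ : ∀ u → mem (const u) → val u ℚ.≤ 0ℚ → ⊥
        ≤0⇒⊥ u u∈ u≤0 = proper (mp u∈ (const≼ {u} {0₀₁} u≤0))
        meet : ℚ₀₁ → ℚ₀₁
        meet u = compl (plus (compl u) (compl t))
        meet∈ : ∀ u → mem (const u) → mem (const (meet u))
        meet∈ u u∈ = ∈-resp (begin
          ∼ (∼ const u ⊕ ∼ const t)                    ≈⟨ ∼-cong (⊕.∙-cong (∼const u) (∼const t)) ⟩
          ∼ (const (compl u) ⊕ const (compl t))        ≈⟨ ∼-cong (const-⊕ _ _ _ refl) ⟩
          ∼ const (plus (compl u) (compl t))           ≈⟨ ∼const _ ⟩
          const (meet u)                               ∎) (·-closed u∈ t∈)
        descend : ∀ n u → mem (const u) → val u ℚ.≤ n ×ℚ ε → ⊥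
        descend zero    u u∈ u≤0 = ≤0⇒⊥ u u∈ u≤0
        descend (suc n) u u∈ u≤ with ℚ.≤-total (val (compl u) ℚ.+ val (compl t)) 1ℚ
        ... | inj₁ s≤1 = descend n (meet u) (meet∈ u u∈) (subst (ℚ._≤ n ×ℚ ε)
                (≡.cong (λ s → 1ℚ ℚ.- s) (≡.sym (ℚ.p≤q⇒p⊓q≡p s≤1)))
                (shift≤ (solve 3 (λ u t k → ((con 1ℚ :- t) :+ k) :- u :=
                           k :- (con 1ℚ :- ((con 1ℚ :- u) :+ (con 1ℚ :- t)))) refl (val u) (val t) (n ×ℚ ε)) u≤))
        ... | inj₂ 1≤s = ≤0⇒⊥ (meet u) (meet∈ u u∈)
                (ℚ.≤-reflexive (≡.cong (λ s → 1ℚ ℚ.- s) (ℚ.p≥q⇒p⊓q≡q 1≤s)))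

      const≼⇒≤ : ∀ {r s} → const r ≼ const s → val r ℚ.≤ val s
      const≼⇒≤ {r} {s} r≼s = shift≤
        (solve 2 (λ r s → ((con 1ℚ :- r) :+ s) :- con 1ℚ := s :- r) refl (val r) (val s))
        (ℚ.≤-trans (const∈⇒1≤ (plus (compl r) s)
                     (∈-resp (⊕.trans (⊕-congʳ (∼const r)) (const-⊕ _ _ _ refl)) r≼s))
                   (ℚ.p⊓q≤p (val (compl r) ℚ.+ val s) 1ℚ))
        where open ℚ-Solver

      approx : ∀ x {δ} → 0ℚ ℚ.< δ →
               ∃ λ r → ∃ λ s → const r ≼ x × x ≼ const s × val s ℚ.≤ val r ℚ.+ δ
      approx x {δ} 0<δ = let (n , 1≤nδ) = archimedean 0<δ in
        search n 0₀₁ (0≼ x) (ℚ.≤-trans 1≤nδ (ℚ.≤-reflexive (≡.sym (ℚ.+-identityˡ _))))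
        where
        search : ∀ n r → const r ≼ x → 1ℚ ℚ.≤ val r ℚ.+ n ×ℚ δ →
                 ∃ λ r → ∃ λ s → const r ≼ x × x ≼ const s × val s ℚ.≤ val r ℚ.+ δ
        top : ∀ r → const r ≼ x → 1ℚ ℚ.≤ val r ℚ.+ δ →
              ∃ λ r → ∃ λ s → const r ≼ x × x ≼ const s × val s ℚ.≤ val r ℚ.+ δ
        top r r≼x 1≤ = r , 1₀₁ , r≼x , ≼-trans (≼1 x) (≼-refl const-1) , 1≤
        search zero r r≼x 1≤r = top r r≼x (ℚ.≤-trans 1≤r (ℚ.+-monoʳ-≤ (val r) (ℚ.<⇒≤ 0<δ)))
        search (suc n) r r≼x 1≤ with ℚ.≤-total (val r ℚ.+ δ) 1ℚ
        ... | inj₂ 1≤r+δ = top r r≼x 1≤r+δ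
        ... | inj₁ r+δ≤1 with ≼-total x (const s)
          where
          s : ℚ₀₁
          s = mkℚ₀₁ (val r ℚ.+ δ) (ℚ.+-mono-≤ (0≤val r) (ℚ.<⇒≤ 0<δ)) r+δ≤1
        ...   | inj₁ x≼s = r , _ , r≼x , x≼s , ℚ.≤-refl
        ...   | inj₂ s≼x = search n _ s≼x (ℚ.≤-trans 1≤ (ℚ.≤-reflexive (≡.sym (ℚ.+-assoc (val r) δ _))))

      multiple-mono : ∀ n {x y} → x ≼ y → multiple n x ≼ multiple n y
      multiple-mono zero    x≼y = ≼-refl ⊕.refl
      multiple-mono (suc n) x≼y = ⊕-mono x≼y (multiple-mono n x≼y)

      multiple-const : ∀ n r → ∃ λ s → multiple n (const r) ≼ const s × val s ℚ.≤ n ×ℚ val r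
      multiple-const zero    r = 0₀₁ , ≼-refl ⊕.refl , ℚ.≤-refl
      multiple-const (suc n) r = let (s , p , q) = multiple-const n r in
        plus r s ,
        ≼-trans (⊕-monoʳ _ p) (≼-refl (const-⊕ r s _ refl)) ,
        ℚ.≤-trans (ℚ.p⊓q≤p (val r ℚ.+ val s) 1ℚ) (ℚ.+-monoʳ-≤ (val r) q)

      ∉-bound : ∀ {x} → ¬ mem x → ∃ λ (δ : ℚ₀₁) → 0ℚ ℚ.< val δ × ¬ (∼ x ≼ const δ)
      ∉-bound {x} x∉ = let (n , p) = generated x∉ in
        δ n , 0<recip n , λ d≼δ →
          let (s , q , s≤nδ) = multiple-const n (δ n)
              1≤s = const∈⇒1≤ s (mp (mp p (multiple-mono n d≼δ)) q)
          in ℚ.<-irrefl refl (ℚ.<-≤-trans (nδ<1 n) (ℚ.≤-trans 1≤s s≤nδ))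
        where
        δ : ℕ → ℚ₀₁
        δ n = mkℚ₀₁ (recip n) (ℚ.<⇒≤ (0<recip n)) (recip≤1 n)
        nδ<1 : ∀ n → n ×ℚ recip n ℚ.< 1ℚ
        nδ<1 n = subst (n ×ℚ recip n ℚ.<_) (×recip n)
          (subst (ℚ._< recip n ℚ.+ n ×ℚ recip n) (ℚ.+-identityˡ (n ×ℚ recip n)) (ℚ.+-monoˡ-< (n ×ℚ recip n) (0<recip n)))

      ⌊_⌋ : Set (c ⊔ ℓ) → Set
      ⌊ P ⌋ = True (em {P = P})

      Below : Carrier → ℚ → Set (c ⊔ ℓ)
      Below x q = ∃ λ r → q ℚ.< val r × const r ≼ x

      image : Carrier → 𝕀
      image x = mk𝕀 (record
        { L         = λ q → ⌊ Below x q ⌋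
        ; inhabited = ℚ.- 1ℚ , fromWitness (0₀₁ , ℚ.negative⁻¹ (ℚ.- 1ℚ) , 0≼ x)
        ; bounded   = 1ℚ , λ p → let (r , 1<r , _) = toWitness p in ℚ.<-irrefl refl (ℚ.<-≤-trans 1<r (val≤1 r))
        ; lower     = λ p<q b → let (r , q<r , r≼x) = toWitness b in fromWitness (r , ℚ.<-trans p<q q<r , r≼x)
        ; rounded   = λ b → let (r , q<r , r≼x) = toWitness b ; (s , q<s , s<r) = ℚ.<-dense q<r in
            s , q<s , fromWitness (r , s<r , r≼x)
        })
        (λ q<0 → fromWitness (0₀₁ , q<0 , 0≼ x))
        (λ b → let (r , q<r , _) = toWitness b in ℚ.<-≤-trans q<r (val≤1 r))

      Cut : Carrier → ℚ → Set
      Cut x = L (real (image x))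

      ∈-image : ∀ {x q} r → q ℚ.< val r → const r ≼ x → Cut x q
      ∈-image r q<r r≼x = fromWitness (r , q<r , r≼x)

      image∈ : ∀ {x q} → Cut x q → Below x q
      image∈ = toWitness

      ∉-image : ∀ {x q} r → ¬ Cut x q → q ℚ.< val r → x ≼ const r
      ∉-image {x} r q∉ q<r with ≼-total x (const r)
      ... | inj₁ x≼r = x≼r
      ... | inj₂ r≼x = ⊥-elim (q∉ (∈-image r q<r r≼x))

      image<  : ∀ {x q} s → x ≼ const s → Cut x q → q ℚ.< val s
      image< s x≼s q∈ = let (r , q<r , r≼x) = image∈ q∈ in
        ℚ.<-≤-trans q<r (const≼⇒≤ {r} {s} (≼-trans r≼x x≼s))

      image-mono : ∀ {x y} → x ≼ y → image x ≤ᴵ image y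
      image-mono x≼y q∈ = let (r , q<r , r≼x) = image∈ q∈ in ∈-image r q<r (≼-trans r≼x x≼y)

      difference : ∀ {x y} (s r δ : ℚ₀₁) → x ≼ const s → const r ≼ y →
                   val s ℚ.≤ val r ℚ.+ val δ → ∼ (x ⇒ y) ≼ const δ
      difference {x} {y} s r δ x≼s r≼y s≤r+δ =
        ≼-trans (∼-anti (⊕-mono (∼-anti x≼s) r≼y)) (≼-trans (≼-refl (begin
          ∼ (∼ const s ⊕ const r)             ≈⟨ ∼-cong (⊕-congʳ (∼const s)) ⟩
          ∼ (const (compl s) ⊕ const r)       ≈⟨ ∼-cong (const-⊕ _ _ _ refl) ⟩
          ∼ const (plus (compl s) r)          ≈⟨ ∼const _ ⟩
          const (compl (plus (compl s) r))    ∎))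
        (const≼ {compl (plus (compl s) r)} {δ} (minus-bound {val s} {val r} {val δ} s≤r+δ (0≤val δ))))

      image-cancel : ∀ {x y} → image x ≤ᴵ image y → x ≼ y
      image-cancel {x} {y} x≤y with em {P = x ≼ y}
      ... | yes p = p
      ... | no ¬p = ⊥-elim
        (let (δ , 0<δ , ¬d≼δ) = ∉-bound ¬p
             (η , 0<η , η+η≡δ) = halve 0<δ
             (r , s , r≼x , x≼s , s≤r+η) = approx x 0<η
             (r′ , s′ , r′≼y , y≼s′ , s′≤r′+η) = approx y 0<η
             r≤s′ = ℚ.≮⇒≥ {val s′} {val r} λ s′<r →
                      ℚ.<-irrefl refl (image< s′ y≼s′ (x≤y (∈-image r s′<r r≼x)))
         in ¬d≼δ (difference s r′ δ x≼s r′≼y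
              (add-gaps {val r} {val s} {val r′} {val s′} {η} s≤r+η r≤s′ s′≤r′+η η+η≡δ)))

      image-const : ∀ r → image (const r) Std.≈ Std.const r
      image-const r = image< r (≼-refl ⊕.refl) , λ q<r → ∈-image r q<r (≼-refl ⊕.refl)

      image-∼ : ∀ x → image (∼ x) Std.≈ (Std.∼ image x)
      image-∼ x = to , from
        where
        open ℚ-Solver
        to : image (∼ x) ≤ᴵ (Std.∼ image x)
        to {q} q∈ = let (r , q<r , r≼∼x) = image∈ q∈
                        x≼ = ≼-trans (≼-refl (⊕.sym (∼-involutive x))) (≼-trans (∼-anti r≼∼x) (≼-refl (∼const r)))
          in q ℚ.+ val (compl r) , val (compl r) ,
             shift< (solve 2 (λ q r → r :- q := con 1ℚ :- (q :+ (con 1ℚ :- r))) refl q (val r)) q<r ,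
             (λ r∈ → ℚ.<-irrefl refl (image< (compl r) x≼ r∈)) ,
             solve 2 (λ q r → q := (q :+ r) :- r) refl q (val (compl r))
        above : ∀ {t p} m → ¬ Cut x t → p ℚ.< m → m ℚ.< 1ℚ ℚ.- t → Cut (∼ x) p
        above {t} {p} m t∉ p<m m<1-t with ℚ.≤-total m 0ℚ
        ... | inj₁ m≤0 = 0≤ (image (∼ x)) (ℚ.<-≤-trans p<m m≤0)
        ... | inj₂ 0≤m = ∈-image r p<m (≼-trans (≼-refl (⊕.sym r≈)) (∼-anti (∉-image (compl r) t∉ t<)))
          where
          t≥0 : 0ℚ ℚ.≤ t
          t≥0 = ∉⇒0≤ (image x) t∉
          r : ℚ₀₁
          r = mkℚ₀₁ m 0≤m (ℚ.≤-trans (ℚ.<⇒≤ m<1-t)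
                (shift≤ (solve 1 (λ t → t :- con 0ℚ := con 1ℚ :- (con 1ℚ :- t)) refl t) t≥0))
          r≈ : ∼ const (compl r) ≈ const r
          r≈ = const-∼ (compl r) r (solve 1 (λ m → con 1ℚ :- (con 1ℚ :- m) := m) refl m)
          t< : t ℚ.< 1ℚ ℚ.- m
          t< = shift< (solve 2 (λ m t → (con 1ℚ :- t) :- m := (con 1ℚ :- m) :- t) refl m t) m<1-t
        from : (Std.∼ image x) ≤ᴵ image (∼ x)
        from (s , t , s<1 , t∉ , refl) =
          let (m , p<m , m<1-t) = ℚ.<-dense (ℚ.+-monoˡ-< (ℚ.- t) s<1) in above m t∉ p<m m<1-t

      image-⊕ : ∀ x y → image (x ⊕ y) Std.≈ (image x Std.⊕ image y)
      image-⊕ x y = to , from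
        where
        from : (image x Std.⊕ image y) ≤ᴵ image (x ⊕ y)
        from ((s , t , s∈ , t∈ , refl) , s+t<1) =
          let (r , s<r , r≼x) = image∈ s∈ ; (r′ , t<r′ , r′≼y) = image∈ t∈ in
          ∈-image (plus r r′)
            (<-⊓ (ℚ.+-mono-< s<r t<r′) s+t<1)
            (≼-trans (≼-refl (⊕.sym (const-⊕ r r′ _ refl))) (⊕-mono r≼x r′≼y))
        to : image (x ⊕ y) ≤ᴵ (image x Std.⊕ image y)
        to {q} q∈ =
          let (r , q<r , r≼) = image∈ q∈
              (η , 0<η , gap) = split-gap q<r
              (u , s , u≼x , x≼s , s≤u+η) = approx x 0<η
              (v , t , v≼y , y≼t , t≤v+η) = approx y 0<η
              r≤ = const≼⇒≤ {r} {plus s t} (≼-trans r≼ (≼-trans (⊕-mono x≼s y≼t) (≼-refl (const-⊕ s t _ refl))))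
              (m , q-v<m , m<u) = ℚ.<-dense (remainder {q} {val r} {η} {val u} {val v} {val s} {val t} gap r≤ s≤u+η t≤v+η)
          in (m , q ℚ.- m , ∈-image u m<u u≼x ,
              ∈-image v (swap-minus {q} {val v} {m} q-v<m) v≼y , add-minus q m)
             , ℚ.<-≤-trans q<r (val≤1 r)

    quotient-embedding : ∃ λ h → IsPavelkaMonomorphism (quotient A F) standard h
    quotient-embedding = image , record
      { cong       = λ (x≼y , y≼x) → image-mono x≼y , image-mono y≼x
      ; ⊕-homo     = image-⊕
      ; ∼-homo     = image-∼
      ; const-homo = image-const
      ; injective  = λ (x≤y , y≤x) → image-cancel x≤y , image-cancel y≤x
      }

    quotient-embedding-unique : ∀ {h} → IsPavelkaMonomorphism (quotient A F) standard h →
                                ∀ x → h x Std.≈ proj₁ quotient-embedding x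
    quotient-embedding-unique {h} mono x = to , from
      where
      open IsPavelkaMonomorphism mono
      h-mono : ∀ {y z} → y ≼ z → h y ≤ᴵ h z
      h-mono {y} {z} y≼z = ⇒-top (h y) (h z) λ q<1 →
        ⊕-congᴵ {h (∼ y)} {Std.∼ h y} {h z} {h z} (proj₁ (∼-homo y)) (λ q∈ → q∈)
          (proj₁ (⊕-homo (∼ y) z)
            (proj₁ (cong
                ( ∈-resp (⊕.sym (⊕.trans (⊕-congʳ (⊕.trans (∼-cong (⊕.sym const-1)) ∼1≈0)) (⊕.identityˡ _))) y≼z
                , ∈-1 (⊕.trans (⊕-congˡ (⊕.sym const-1)) (⊕-zeroʳ _))))
              (proj₂ (const-homo 1₀₁) q<1)))
      to : h x ≤ᴵ image x
      to {q} q∈ with rounded (real (h x)) q∈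
      ... | r , q<r , r∈ with ℚ.≤-total r 0ℚ
      ...   | inj₁ r≤0 = 0≤ (image x) (ℚ.<-≤-trans q<r r≤0)
      ...   | inj₂ 0≤r with ≼-total x (const (mkℚ₀₁ r 0≤r (ℚ.<⇒≤ (≤1 (h x) r∈))))
      ...     | inj₁ x≼r = ⊥-elim (ℚ.<-irrefl refl (proj₁ (const-homo _) (h-mono x≼r r∈)))
      ...     | inj₂ r≼x = ∈-image _ q<r r≼x
      from : image x ≤ᴵ h x
      from q∈ = let (r , q<r , r≼x) = image∈ q∈ in h-mono r≼x (proj₂ (const-homo r) q<r)

module Classical (em : ∀ {ℓ} → ExcludedMiddle ℓ) where

  -- The bound r ≤ 1 only matters for empty I, where the infimum in [0,1] is 1.
  -- Excluded middle brings the cut down to Set, whatever the level of I.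
  ⋀ : {I : Set i} → (I → 𝕀) → 𝕀
  ⋀ {I = I} x = mk𝕀 (record
    { L         = λ q → True (em {P = Below q})
    ; inhabited = ℚ.- 1ℚ , fromWitness (neg (ℚ.negative⁻¹ (ℚ.- 1ℚ)))
    ; bounded   = 1ℚ , λ b → ℚ.<-irrefl refl (below-1 (toWitness b))
    ; lower     = λ p<q b → let (r , q<r , r≤1 , r∈) = toWitness b in
                    fromWitness (r , ℚ.<-trans p<q q<r , r≤1 , r∈)
    ; rounded   = λ b → let (r , q<r , r≤1 , r∈) = toWitness b ; (s , q<s , s<r) = ℚ.<-dense q<r in
                    s , q<s , fromWitness (r , s<r , r≤1 , r∈)
    })
    (λ q<0 → fromWitness (neg q<0))
    (λ b → below-1 (toWitness b))
    where
    Below : ℚ → Set _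
    Below q = ∃ λ r → q ℚ.< r × r ℚ.≤ 1ℚ × ∀ k → L (real (x k)) r
    neg : ∀ {q} → q ℚ.< 0ℚ → Below q
    neg q<0 = let (r , q<r , r<0) = ℚ.<-dense q<0 in
      r , q<r , ℚ.<⇒≤ (ℚ.<-trans r<0 (ℚ.positive⁻¹ 1ℚ)) , λ k → 0≤ (x k) r<0
    below-1 : ∀ {q} → Below q → q ℚ.< 1ℚ
    below-1 (r , q<r , r≤1 , _) = ℚ.<-≤-trans q<r r≤1

  ⋀-lower : {I : Set i} (x : I → 𝕀) → ∀ k → ⋀ x ≤ᴵ x k
  ⋀-lower x k b = let (r , q<r , _ , r∈) = toWitness b in lower (real (x k)) q<r (r∈ k)

  ⋀-greatest : {I : Set i} (x : I → 𝕀) (y : 𝕀) → (∀ k → y ≤ᴵ x k) → y ≤ᴵ ⋀ x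
  ⋀-greatest x y y≤ q∈ = let (r , q<r , r∈) = rounded (real y) q∈ in
    fromWitness (r , q<r , ℚ.<⇒≤ (≤1 y r∈) , λ k → y≤ k r∈)

  -- The image of x / F under the embedding of A / F into [0,1], which is unique
  -- by quotient-embedding-unique.
  value : (A : PavelkaAlgebra c ℓ) → SpecM A → PavelkaAlgebra.Carrier A → 𝕀
  value A F = proj₁ (quotient-embedding A em F)

  f[_] : {I : Set a} {J : Set b} → (I → J → 𝕀) → (I → 𝕀) → (J → 𝕀)
  f[ R ] x j = ⋀ λ i → R i j Std.⇒ x i

  relation : (A : PavelkaAlgebra a ℓ) (B : PavelkaAlgebra b ℓ′) →
             (PavelkaAlgebra.Carrier A → PavelkaAlgebra.Carrier B) → SpecM A → SpecM B → 𝕀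
  relation A B f F G = ⋀ λ x → value B G (f x) Std.⇒ value A F x

{-# OPTIONS --safe #-}
-- (i) A {0,1}-valued R makes R(i,j) → x(i) either x(i) or 1, and both cases are
-- compatible with products.
-- (ii) The hypothesis makes P = {a | f(a) ∈ G} a filter of A.  If P ⊆ F, then
-- f(a)/G ≤ a/F for all a: a rational r strictly between a/F and f(a)/G would
-- put r → a into P but not into F, as f(r → a) = r → f(a).  So R(F,G) = 1.
-- Otherwise P and F generate an improper filter by maximality of F, which gives
-- p ∈ P with p/F = 0.  As f(p)/G = 1, it follows that R(F,G) = 0.
module Submission where

open import Defs
open import Axiom.ExcludedMiddle using (ExcludedMiddle)
open import Algebra.Structures using (IsCommutativeMonoid)
open import Data.Product using (∃; _×_; _,_; proj₁; proj₂)
open import Data.Rational.Base as ℚ using (ℚ; 0ℚ; 1ℚ)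
import Data.Rational.Properties as ℚ
open import Data.Rational.Solver using (module +-*-Solver)
open import Data.Sum using (_⊎_; inj₁; inj₂)
open import Function.Base using (_∘_)
open import Level using (Level)
open import Relation.Binary.PropositionalEquality using (_≡_; refl; cong; subst₂; module ≡-Reasoning)
open import Relation.Nullary using (yes; no)
open import Relation.Nullary.Decidable using (True; toWitness; fromWitness)

open ℝ
open 𝕀

private variable
  a b c ℓ ℓ₁ ℓ₂ : Level

-- Implication and product on the cuts of [0,1].

<-translate : ∀ c {p q p′ q′} → p ℚ.+ c ≡ p′ → q ℚ.+ c ≡ q′ → p ℚ.< q → p′ ℚ.< q′
<-translate c e e′ p<q = subst₂ ℚ._<_ e e′ (ℚ.+-monoˡ-< c p<q)

-- `Std.1#` is the difference of cuts `1ʳ -ʳ 0ʳ` rather than `1ʳ` itself; this converts between the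
-- two forms of the unit.
1≤Std1 : 1ʳ ≤ʳ real Std.1#
1≤Std1 {q} q<1 = q , 0ℚ , q<1 , ℚ.<-irrefl refl , solve 1 (λ q → q := q :- con 0ℚ) refl q
  where open +-*-Solver

-- A rational below `x Std.⇒ y` is at most `(s - t) + w` with `s < 1`, `t ∉ x` and `w ∈ y`. Since
-- `x` is 1, `t ≥ 1`, so the sum is less than `w`.
⇒-detach : ∀ x y → 1ʳ ≤ʳ real x → (x Std.⇒ y) ≤ᴵ y
⇒-detach x y 1≤x ((_ , w , (s , t , s<1 , t∉ , refl) , w∈ , refl) , _) = lower (real y)
  (<-translate (w ℚ.- t)
    (solve 3 (λ s t w → s :+ (w :- t) := (s :- t) :+ w) refl s t w)
    (solve 2 (λ t w → t :+ (w :- t) := w) refl t w)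
    (ℚ.<-≤-trans s<1 (ℚ.≮⇒≥ (t∉ ∘ 1≤x)))) w∈
  where open +-*-Solver

⇒-weaken : ∀ x y → y ≤ᴵ (x Std.⇒ y)
⇒-weaken x y {q} q∈ =
  let (w , q<w , w∈) = rounded (real y) q∈ in
  -- As `q - w` is negative, it lies below `Std.∼ x`, witnessed by subtracting 1, which is never in
  -- the cut of `x`.
  ( q ℚ.- w , w
  , ( 1ℚ ℚ.+ (q ℚ.- w) , 1ℚ
    , <-translate (1ℚ ℚ.- w)
        (solve 2 (λ q w → q :+ (con 1ℚ :- w) := con 1ℚ :+ (q :- w)) refl q w)
        (solve 1 (λ w → w :+ (con 1ℚ :- w) := con 1ℚ) refl w) q<w
    , ℚ.<-irrefl refl ∘ ≤1 x
    , solve 2 (λ q w → q :- w := (con 1ℚ :+ (q :- w)) :- con 1ℚ) refl q w )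
  , w∈ , solve 2 (λ q w → q := (q :- w) :+ w) refl q w )
  , ≤1 y q∈
  where open +-*-Solver

⇒-vacuous : ∀ x y → real x ≤ʳ 0ʳ → 1ʳ ≤ʳ real (x Std.⇒ y)
⇒-vacuous x y x≤0 {q} q<1 =
  let (m , q<m , m<1) = ℚ.<-dense q<1 in
  ( m , q ℚ.- m
  , (m , 0ℚ , m<1 , ℚ.<-irrefl refl ∘ x≤0 , solve 1 (λ m → m := m :- con 0ℚ) refl m)
  , 0≤ y (<-translate (ℚ.- m) refl (ℚ.+-inverseʳ m) q<m)
  , solve 2 (λ q m → q := m :+ (q :- m)) refl q m )
  , q<1
  where open +-*-Solver

⇒-true⇒≤ : ∀ x y → 1ʳ ≤ʳ real (x Std.⇒ y) → x ≤ᴵ y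
⇒-true⇒≤ x y 1≤ {q} q∈ =
  let (r , q<r , r∈) = rounded (real x) q∈
      -- The rational `1 - (r - q)` splits as `(s - t) + w` with `s < 1` and `r < t`, and these
      -- force `q < w`.
      ((_ , _ , (_ , _ , s<1 , t∉ , u≡) , w∈ , e) , _) = 1≤ (p<1 q<r)
  in lower (real y) (q<w u≡ e s<1 (below (real x) r∈ t∉)) w∈
  where
  open +-*-Solver
  p<1 : ∀ {r} → q ℚ.< r → 1ℚ ℚ.- (r ℚ.- q) ℚ.< 1ℚ
  p<1 {r} = <-translate (1ℚ ℚ.- r)
    (solve 2 (λ q r → q :+ (con 1ℚ :- r) := con 1ℚ :- (r :- q)) refl q r)
    (solve 1 (λ r → r :+ (con 1ℚ :- r) := con 1ℚ) refl r)
  q<w : ∀ {r s t u w} → u ≡ s ℚ.- t → 1ℚ ℚ.- (r ℚ.- q) ≡ u ℚ.+ w → s ℚ.< 1ℚ → r ℚ.< t → q ℚ.< w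
  q<w {r} {s} {t} {w = w} refl e s<1 r<t = <-translate (w ℚ.- (1ℚ ℚ.+ t))
    (begin
      (s ℚ.+ r) ℚ.+ (w ℚ.- (1ℚ ℚ.+ t))
        ≡⟨ solve 4 (λ s r w t → (s :+ r) :+ (w :- (con 1ℚ :+ t)) := ((s :- t) :+ w) :+ (r :- con 1ℚ)) refl s r w t ⟩
      ((s ℚ.- t) ℚ.+ w) ℚ.+ (r ℚ.- 1ℚ)     ≡⟨ cong (ℚ._+ (r ℚ.- 1ℚ)) e ⟨
      (1ℚ ℚ.- (r ℚ.- q)) ℚ.+ (r ℚ.- 1ℚ)
        ≡⟨ solve 2 (λ q r → (con 1ℚ :- (r :- q)) :+ (r :- con 1ℚ) := q) refl q r ⟩
      q                                    ∎)
    (solve 2 (λ w t → (con 1ℚ :+ t) :+ (w :- (con 1ℚ :+ t)) := w) refl w t)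
    (ℚ.+-mono-< s<1 r<t)
    where open ≡-Reasoning

∼-anti : ∀ {x y} → x ≤ᴵ y → (Std.∼ y) ≤ᴵ (Std.∼ x)
∼-anti x≤y (s , t , s<1 , t∉ , e) = s , t , s<1 , t∉ ∘ x≤y , e

⊕-mono : ∀ {x x′ y y′} → x ≤ᴵ x′ → y ≤ᴵ y′ → (x Std.⊕ y) ≤ᴵ (x′ Std.⊕ y′)
⊕-mono x≤x′ y≤y′ ((s , t , s∈ , t∈ , e) , q<1) = (s , t , x≤x′ s∈ , y≤y′ t∈ , e) , q<1

·-mono : ∀ {x x′ y y′} → x ≤ᴵ x′ → y ≤ᴵ y′ → (x Std.· y) ≤ᴵ (x′ Std.· y′)
·-mono {x} {x′} {y} {y′} x≤x′ y≤y′ =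
  ∼-anti {Std.∼ x′ Std.⊕ Std.∼ y′} {Std.∼ x Std.⊕ Std.∼ y}
    (⊕-mono {Std.∼ x′} {Std.∼ x} {Std.∼ y′} {Std.∼ y} (∼-anti {x} {x′} x≤x′) (∼-anti {y} {y′} y≤y′))

-- Identities of MV-algebras.

module _ (A : PavelkaAlgebra c ℓ) where
  open PavelkaAlgebra A
  private module ⊕ = IsCommutativeMonoid ⊕-isCommutativeMonoid

  1⇒x≈x : ∀ x → (1# ⇒ x) ≈ x
  1⇒x≈x x = ⊕.trans (⊕.∙-cong (∼-involutive 0#) ⊕.refl) (⊕.identityˡ x)

  -- The Łukasiewicz axiom for `x` and `1#`: one side is `(1# ⇒ x) ⇒ x`, the other ends in `⊕ 1#`
  -- and collapses.
  x⇒x≈1 : ∀ x → (x ⇒ x) ≈ 1#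
  x⇒x≈1 x = ⊕.trans (⊕.∙-cong (∼-cong (⊕.sym (1⇒x≈x x))) ⊕.refl)
    (⊕.trans (⊕.sym (łukasiewicz x 1#)) (⊕-zeroʳ _))

  ≈⇒≤ : ∀ {x y} → x ≈ y → x ≤ y
  ≈⇒≤ {x} x≈y = ⊕.trans (⊕.∙-cong ⊕.refl (⊕.sym x≈y)) (x⇒x≈1 x)

module _ (em : ∀ {ℓ} → ExcludedMiddle ℓ) where
  open Classical em

  f[]-submultiplicative : {I : Set a} {J : Set b} (R : I → J → 𝕀) → ZeroOneValued R →
    (x y : I → 𝕀) (k : J) → (f[ R ] x k Std.· f[ R ] y k) ≤ᴵ f[ R ] (λ l → x l Std.· y l) k
  f[]-submultiplicative R R∈01 x y k = ⋀-greatest (λ l → R l k Std.⇒ (x l Std.· y l)) lhs pointwise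
    where
    lhs : 𝕀
    lhs = f[ R ] x k Std.· f[ R ] y k
    pointwise : ∀ l → lhs ≤ᴵ (R l k Std.⇒ (x l Std.· y l))
    pointwise l with R∈01 l k
    ... | inj₁ (R≤0 , _) = λ q∈ → ⇒-vacuous (R l k) (x l Std.· y l) R≤0 (≤1 lhs q∈)
    ... | inj₂ (_ , 1≤R) = λ q∈ → ⇒-weaken (R l k) (x l Std.· y l)
          (·-mono {f[ R ] x k} {x l} {f[ R ] y k} {y l} (detached x) (detached y) q∈)
      where
      detached : ∀ z → f[ R ] z k ≤ᴵ z l
      detached z q∈ = ⇒-detach (R l k) (z l) (λ q<1 → 1≤R (1≤Std1 q<1))
        (⋀-lower (λ i → R i k Std.⇒ z i) l q∈)

  -- Values modulo a maximal filter.

  module _ (A : PavelkaAlgebra c ℓ) (F : SpecM A) where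
    open PavelkaAlgebra A
    open MaximalFilter F
    private
      module ⊕ = IsCommutativeMonoid ⊕-isCommutativeMonoid
      v = value A F
      module V = IsPavelkaMonomorphism (proj₂ (quotient-embedding A em F))

    value-const : ∀ r → v (const r) Std.≈ Std.const r
    value-const = V.const-homo

    value-0≤0 : real (v 0#) ≤ʳ 0ʳ
    value-0≤0 = proj₁ (value-const 0₀₁)

    1≤value-1 : 1ʳ ≤ʳ real (v 1#)
    1≤value-1 q<1 = proj₂ (V.∼-homo 0#) (∼-anti {v 0#} {Std.0#} value-0≤0 (1≤Std1 q<1))

    -- Membership in `F` means being identified with `1#` in the quotient, which the embedding sends
    -- to 1. The converse rests on injectivity.
    ∈⇒1≤value : ∀ {x} → mem x → 1ʳ ≤ʳ real (v x)
    ∈⇒1≤value {x} x∈ q<1 = proj₂ (V.cong {x} {1#}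
      ( ≤-closed (≈⇒≤ A (⊕.sym (⊕-zeroʳ (∼ x)))) 1∈
      , ≤-closed (≈⇒≤ A (⊕.sym (1⇒x≈x A x))) x∈ )) (1≤value-1 q<1)

    1≤value⇒∈ : ∀ {x} → 1ʳ ≤ʳ real (v x) → mem x
    1≤value⇒∈ {x} 1≤ = ≤-closed (≈⇒≤ A (1⇒x≈x A x))
      (proj₂ (V.injective {x} {1#} ((λ q∈ → 1≤value-1 (≤1 (v x) q∈)) , (λ q∈ → 1≤ (≤1 (v 1#) q∈)))))

    value-⇒ : ∀ x y → v (x ⇒ y) Std.≈ (v x Std.⇒ v y)
    value-⇒ x y =
      (λ q∈ → ⊕-mono {v (∼ x)} {Std.∼ v x} {v y} {v y} (proj₁ (V.∼-homo x)) (λ p∈ → p∈) (proj₁ (V.⊕-homo (∼ x) y) q∈)) ,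
      (λ q∈ → proj₂ (V.⊕-homo (∼ x) y) (⊕-mono {Std.∼ v x} {v (∼ x)} {v y} {v y} (proj₂ (V.∼-homo x)) (λ p∈ → p∈) q∈))

    value-· : ∀ x y → v (x · y) Std.≈ (v x Std.· v y)
    value-· x y =
      (λ q∈ → ∼-anti {w} {v (∼ x ⊕ ∼ y)} (λ p∈ → proj₂ (V.⊕-homo (∼ x) (∼ y))
        (⊕-mono {Std.∼ v x} {v (∼ x)} {Std.∼ v y} {v (∼ y)} (proj₂ (V.∼-homo x)) (proj₂ (V.∼-homo y)) p∈))
        (proj₁ (V.∼-homo (∼ x ⊕ ∼ y)) q∈)) ,
      (λ q∈ → proj₂ (V.∼-homo (∼ x ⊕ ∼ y)) (∼-anti {v (∼ x ⊕ ∼ y)} {w}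
        (λ p∈ → ⊕-mono {v (∼ x)} {Std.∼ v x} {v (∼ y)} {Std.∼ v y} (proj₁ (V.∼-homo x)) (proj₁ (V.∼-homo y))
          (proj₁ (V.⊕-homo (∼ x) (∼ y)) p∈)) q∈))
      where
      w : 𝕀
      w = Std.∼ v x Std.⊕ Std.∼ v y

    ⇒∈⇒value≤ : ∀ {x y} → mem (x ⇒ y) → v x ≤ᴵ v y
    ⇒∈⇒value≤ {x} {y} xy∈ = ⇒-true⇒≤ (v x) (v y) λ q<1 → proj₁ (value-⇒ x y) (∈⇒1≤value xy∈ q<1)

    -- The value of y ⇒ y is 1, which provides the points of the cut of v y at
    -- arbitrarily small distance needed here.
    ≤value⇒1≤⇒ : ∀ x y → x ≤ᴵ v y → 1ʳ ≤ʳ real (x Std.⇒ v y)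
    ≤value⇒1≤⇒ x y x≤ q<1 = ⊕-mono {Std.∼ v y} {Std.∼ x} {v y} {v y}
      (∼-anti {x} {v y} x≤) (λ p∈ → p∈) (proj₁ (value-⇒ y y)
      (∈⇒1≤value (≤-closed (≈⇒≤ A (⊕.sym (x⇒x≈1 A y))) 1∈) q<1))

    value≤⇒⇒∈ : ∀ {x y} → v x ≤ᴵ v y → mem (x ⇒ y)
    value≤⇒⇒∈ {x} {y} x≤y = 1≤value⇒∈ λ q<1 → proj₂ (value-⇒ x y) (≤value⇒1≤⇒ (v x) y x≤y q<1)

    -- If no element of `P` has value 0, the filter `H` generated by `P` and `F` is proper: `y ⇒ 0#`
    -- in `F` would force the value of `y` to 0. Maximality then gives `H ⊆ F`, and `P ⊆ H`.
    ∈⊎value≤0 : ∀ {d} {P : Carrier → Set d} → IsFilter rawMVAlgebra P →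
      (∀ {x} → P x → mem x) ⊎ (∃ λ x → P x × real (v x) ≤ʳ 0ʳ)
    ∈⊎value≤0 {P = P} P-filter with em {P = ∃ λ x → P x × real (v x) ≤ʳ 0ʳ}
    ... | yes p = inj₂ p
    ... | no ¬p = inj₁ λ {x} x∈P → maximal H H-filter
      (λ (y , y∈P , y0) → ¬p (y , toWitness y∈P , λ q∈ → value-0≤0 (⇒∈⇒value≤ y0 q∈)))
      -- `F` lies in `H` through the witness `1#`, and each element of `P` through itself.
      (λ {z} z∈ → 1# , fromWitness P.1∈ , ≤-closed (≈⇒≤ A (⊕.sym (1⇒x≈x A z))) z∈)
      (x , fromWitness x∈P , value≤⇒⇒∈ {x} {x} λ q∈ → q∈)
      where
      module P = IsFilter P-filter
      -- The filter generated by P and F.  Excluded middle brings P down to Set,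
      -- so that H has the level over which maximality quantifies.
      H : Carrier → Set _
      H z = ∃ λ y → True (em {P = P y}) × mem (y ⇒ z)
      H-filter : IsFilter rawMVAlgebra H
      H-filter = record
        { 1∈       = 1# , fromWitness P.1∈ , ≤-closed (≈⇒≤ A (⊕.sym (x⇒x≈1 A 1#))) 1∈
        ; ·-closed = λ { {x} {y} (p , p∈ , px) (q , q∈ , qy) → p · q ,
            fromWitness (P.·-closed (toWitness p∈) (toWitness q∈)) ,
            value≤⇒⇒∈ λ l → proj₂ (value-· x y)
              (·-mono {v p} {v x} {v q} {v y} (⇒∈⇒value≤ px) (⇒∈⇒value≤ qy) (proj₁ (value-· p q) l)) }
        ; ≤-closed = λ { {x} {y} x≤y (p , p∈ , px) → p , p∈ ,
            value≤⇒⇒∈ {p} {y} λ q∈ → ⇒∈⇒value≤ {x} {y} (≤-closed (≈⇒≤ A (⊕.sym x≤y)) 1∈) (⇒∈⇒value≤ {p} {x} px q∈) }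
        }

  -- The relation of an adjoint pair.

  relation-ZeroOneValued : (A : PavelkaAlgebra a ℓ₁) (B : PavelkaAlgebra b ℓ₂) →
    let module A = PavelkaAlgebra A
        module B = PavelkaAlgebra B
    in (f : A.Carrier → B.Carrier) (g : B.Carrier → A.Carrier) → PavelkaAdjoint A B f g →
       (∀ x y → f x B.· f y B.≤ f (x A.· y)) →
       ZeroOneValued (relation A B f)
  relation-ZeroOneValued A B f g f⇆g f-· F G = cases (∈⊎value≤0 A F P-filter)
    where
    module A = PavelkaAlgebra A
    module B = PavelkaAlgebra B
    module F = MaximalFilter F
    module G = MaximalFilter G
    open PavelkaAdjoint f⇆g
    P : A.Carrier → Set _
    P x = G.mem (f x)
    P-filter : IsFilter A.rawMVAlgebra P
    P-filter = record
      -- A right adjoint preserves the top: `g 1 ≤ 1` transposes to `1 ≤ f 1`.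
      { 1∈       = G.≤-closed (adjoint⇐ (A.⊕-zeroʳ _)) G.1∈
      ; ·-closed = λ x∈ y∈ → G.≤-closed (f-· _ _) (G.·-closed x∈ y∈)
      ; ≤-closed = λ x≤y → G.≤-closed (f-mono x≤y)
      }
    vᴬ = value A F
    vᴮ = value B G
    family : A.Carrier → 𝕀
    family x = vᴮ (f x) Std.⇒ vᴬ x
    f-bound : (∀ {x} → P x → F.mem x) → ∀ x → vᴮ (f x) ≤ᴵ vᴬ x
    f-bound P⊆F x {q} q∈ with em {P = L (real (vᴬ x)) q}
    ... | yes q∈A = q∈A
    ... | no q∉A = let (s , q<s , s∈) = rounded (real (vᴮ (f x))) q∈ in contra s q<s s∈
      where
      contra : ∀ s → q ℚ.< s → L (real (vᴮ (f x))) s → L (real (vᴬ x)) q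
      contra s q<s s∈ = ⇒∈⇒value≤ A F (P⊆F s⇒x∈P) (proj₂ (value-const A F r) q<s)
        where
        r : ℚ₀₁
        -- A rational outside the cut of an element of [0,1] is nonnegative, so `0 ≤ q < s`; thus
        -- `s` names a constant.
        r = mkℚ₀₁ s (ℚ.≤-trans (∉⇒0≤ (vᴬ x) q∉A) (ℚ.<⇒≤ q<s)) (ℚ.<⇒≤ (≤1 (vᴮ (f x)) s∈))
        s⇒x∈P : P (A.const r A.⇒ x)
        s⇒x∈P = G.≤-closed (≈⇒≤ B (const-⇒ r x)) (value≤⇒⇒∈ B G {B.const r} {f x}
          λ p∈ → lower (real (vᴮ (f x))) (proj₁ (value-const B G r) p∈) s∈)
    cases : (∀ {x} → P x → F.mem x) ⊎ (∃ λ x → P x × real (vᴬ x) ≤ʳ 0ʳ) →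
            relation A B f F G Std.≈ Std.0# ⊎ relation A B f F G Std.≈ Std.1#
    cases (inj₁ P⊆F) = inj₂
      ( (λ q∈ → 1≤Std1 (≤1 (relation A B f F G) q∈))
      , ⋀-greatest family Std.1# (λ x q∈ →
          ≤value⇒1≤⇒ A F (vᴮ (f x)) x (f-bound P⊆F x) (≤1 Std.1# q∈)) )
    cases (inj₂ (p , p∈P , p≤0)) = inj₁
      ( (λ q∈ → p≤0 (⇒-detach (vᴮ (f p)) (vᴬ p) (∈⇒1≤value B G p∈P) (⋀-lower family p q∈)))
      , 0≤ (relation A B f F G) )

theorem10 :
    (em : ∀ {ℓ} → ExcludedMiddle ℓ) → let open Classical em in
    ∀ {i j a ℓ₁ b ℓ₂} →
      ( (I : Set i) (J : Set j) (R : I → J → 𝕀) → ZeroOneValued R →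
        (x y : I → 𝕀) (k : J) →
        (f[ R ] x k Std.· f[ R ] y k) ≤ᴵ f[ R ] (λ l → x l Std.· y l) k )
    × ( (A : PavelkaAlgebra a ℓ₁) (B : PavelkaAlgebra b ℓ₂) →
        let module A = PavelkaAlgebra A
            module B = PavelkaAlgebra B
        in IsSemisimple A → IsSemisimple B →
           (f : A.Carrier → B.Carrier) (g : B.Carrier → A.Carrier) → PavelkaAdjoint A B f g →
           (∀ x y → f x B.· f y B.≤ f (x A.· y)) →
           ZeroOneValued (relation A B f) )
theorem10 em =
    (λ I J → f[]-submultiplicative em {I = I} {J = J}) ,
    λ A B _ _ → relation-ZeroOneValued em A B
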